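{- $\mathsf{EPF}_{\mathbb{B}} \to \mathsf{KT}$. That is: if there is $e : \mathbb{N} \to (\mathbb{N} \rightharpoonup \mathbb{B})$ such that for every partial function $f : \mathbb{N} \rightharpoonup \mathbb{B}$ there exists $n$ with $e\,n \equiv_{\mathbb{N} \rightharpoonup \mathbb{B}} f$, then there exists an infinite, well-founded, decidable binary tree.
   Context: Ambient theory: Coq's type theory (constructive, with a hierarchy of types $\mathbb{T}$ and a separate impredicative universe $\mathbb{P}$ of propositions), with no additional axioms. $\exists$ is propositional existence, $\Sigma$ the dependent pair type, $\mathbb{B}$ the type of booleans, $\mathbb{L}\,\mathbb{B}$ the type of finite lists of booleans. Partial values: one assumes a type $\partial A$ for each type $A$, with a definedness relation $\triangleright : \partial A \to A \to \mathbb{P}$ satisfying $x \triangleright a_1 \to x \triangleright a_2 \to a_1 = a_2$, and operations: $\mathsf{ret} : A \to \partial A$ with $\mathsf{ret}\,a \triangleright a$; $\mathsf{undef} : \partial A$ with $\neg\exists a.\ \mathsf{undef} \triangleright a$; bind $\gg\!= \,: \partial A \to (A \to \partial B) \to \partial B$ with $(x \gg\!= f) \triangleright b \leftrightarrow \exists a.\ x \triangleright a \land f\,a \triangleright b$; $\mu : (\mathbb{N} \to \mathbb{B}) \to \partial \mathbb{N}$ with $\mu f \triangleright n \leftrightarrow f\,n = \mathsf{true} \land \forall m < n.\ f\,m = \mathsf{false}$; $\mathsf{seval} : \partial A \to \mathbb{N} \to \mathrm{option}\,A$ with $x \triangleright a \leftrightarrow \exists n.\ \mathsf{seval}\,x\,n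 = \mathrm{Some}\,a$. Write $A \rightharpoonup B$ for $A \to \partial B$, and $f \equiv_{A \rightharpoonup B} g := \forall x.\,\forall b.\ f\,x \triangleright b \leftrightarrow g\,x \triangleright b$. $\mathsf{EPF}_{\mathbb{B}} := \Sigma e : \mathbb{N} \to (\mathbb{N} \rightharpoonup \mathbb{B}).\ \forall f : \mathbb{N} \rightharpoonup \mathbb{B}.\ \exists n.\ e\,n \equiv_{\mathbb{N} \rightharpoonup \mathbb{B}} f$. A predicate $\tau : \mathbb{L}\,\mathbb{B} \to \mathbb{P}$ is a (decidable) binary tree if (a) $\exists f : \mathbb{L}\,\mathbb{B} \to \mathbb{B}.\ \forall u.\ \tau u \leftrightarrow f\,u = \mathsf{true}$; (b) $\exists u.\ \tau u$; (c) if $\tau u_2$ and $u_1$ is a prefix of $u_2$ then $\tau u_1$. It is infinite if $\forall n.\,\exists u.\ |u| \ge n \land \tau u$, and well-founded if $\forall f : \mathbb{N} \to \mathbb{B}.\ \exists n.\ \neg \tau[f\,0, \dots, f\,n]$. $\mathsf{KT}$ := there exists an infinite, well-founded, decidable binary tree. -}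

module Defs where

open import Data.Bool.Base using (Bool; true; false)
open import Data.List.Base using (List; length; applyUpTo)
open import Data.List.Relation.Binary.Prefix.Heterogeneous using (Prefix)
open import Data.Maybe.Base using (Maybe; just)
open import Data.Nat.Base using (ℕ; suc; _<_; _≥_)
open import Data.Product.Base using (Σ; _×_)
open import Function.Bundles using (_⇔_)
open import Level as Level using (Level; _⊔_)
open import Relation.Binary.PropositionalEquality.Core using (_≡_)
open import Relation.Nullary.Irrelevant using (Irrelevant)
open import Relation.Nullary.Negation.Core using (¬_)

private
  variable
    a b : Level

-- Propositional existence, as opposed to Σ: the second-order encoding of ∃,
-- i.e. the propositional truncation of ∃ B. The witness may be used only to
-- establish a proposition, so ∀ x → ∃ᴾ[ y ] R x y yields no choice function.
∃ᴾ : {A : Set a} → (A → Set b) → Set (Level.suc (a ⊔ b))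
∃ᴾ {a} {b} {A} B =
  (X : Set (a ⊔ b)) → Irrelevant X → (∀ x → B x → X) → X

infix 2 ∃ᴾ
syntax ∃ᴾ (λ x → B) = ∃ᴾ[ x ] B

record Partiality : Set₁ where
  infix  4 _▷_
  infixl 1 _>>=_
  field
    ∂     : Set → Set
    _▷_   : {A : Set} → ∂ A → A → Set
    ret   : {A : Set} → A → ∂ A
    undef : {A : Set} → ∂ A
    _>>=_ : {A B : Set} → ∂ A → (A → ∂ B) → ∂ B
    μ     : (ℕ → Bool) → ∂ ℕ
    seval : {A : Set} → ∂ A → ℕ → Maybe A

    ▷-functional : {A : Set} {x : ∂ A} {a₁ a₂ : A} →
                   x ▷ a₁ → x ▷ a₂ → a₁ ≡ a₂
    ret-spec     : {A : Set} (a : A) → ret a ▷ a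
    undef-spec   : {A : Set} → ¬ (∃ᴾ[ a ] undef {A} ▷ a)
    >>=-spec     : {A B : Set} (x : ∂ A) (f : A → ∂ B) (b : B) →
                   (x >>= f) ▷ b ⇔ (∃ᴾ[ a ] (x ▷ a × f a ▷ b))
    μ-spec       : (f : ℕ → Bool) (n : ℕ) →
                   μ f ▷ n ⇔ (f n ≡ true × (∀ m → m < n → f m ≡ false))
    seval-spec   : {A : Set} (x : ∂ A) (a : A) →
                   x ▷ a ⇔ (∃ᴾ[ n ] seval x n ≡ just a)

module _ (P : Partiality) where
  open Partiality P

  infixr 0 _⇀_
  _⇀_ : Set → Set → Set
  A ⇀ B = A → ∂ B

  Equiv : (A B : Set) → (A ⇀ B) → (A ⇀ B) → Set
  Equiv A B f g = ∀ x b → f x ▷ b ⇔ g x ▷ b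

  syntax Equiv A B f g = f ≡[ A ⇀ B ] g

  EPF𝔹 : Set₁
  EPF𝔹 = Σ (ℕ → (ℕ ⇀ Bool)) λ e → (f : ℕ ⇀ Bool) → ∃ᴾ[ n ] (e n ≡[ ℕ ⇀ Bool ] f)

record IsDecidableBinaryTree (τ : List Bool → Set) : Set₁ where
  field
    decidable    : ∃ᴾ λ (f : List Bool → Bool) → ∀ u → τ u ⇔ f u ≡ true
    inhabited    : ∃ᴾ[ u ] τ u
    prefixClosed : ∀ {u₁ u₂} → Prefix _≡_ u₁ u₂ → τ u₂ → τ u₁

IsInfinite : (List Bool → Set) → Set₁
IsInfinite τ = ∀ n → ∃ᴾ[ u ] (length u ≥ n × τ u)

-- applyUpTo f (suc n) is the list f 0 , … , f n.
IsWellFounded : (List Bool → Set) → Set₁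
IsWellFounded τ = (f : ℕ → Bool) → ∃ᴾ[ n ] (¬ τ (applyUpTo f (suc n)))

KT : Set₂
KT = ∃ᴾ[ τ ] (IsDecidableBinaryTree τ × IsInfinite τ × IsWellFounded τ)

{-# OPTIONS --safe #-}

-- A list u belongs to the tree when the evaluations of e n n, for n < |u|, reveal
-- within |u| steps no value other than the n-th entry of u. An infinite path f
-- would satisfy f n ≡ b whenever e n n ▷ b. Diagonalisation rules this out: the
-- total function not ∘ f is e c for some c, and some stage k reveals the value
-- not (f c) of e c c, so f has left the tree by depth 1 + max c k. At each finite
-- depth only finitely many evaluation steps have to be respected, which yields
-- arbitrarily long nodes.
module Submission where

open import Defs
open import Data.Bool.Base using (Bool; true; not)
open import Data.Bool.Properties using (_≟_; not-¬)
open import Data.Fin.Base using (Fin; zero; suc; toℕ; fromℕ<; inject≤)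
open import Data.Fin.Properties using (all?; toℕ<n; toℕ-fromℕ<; toℕ-inject≤)
open import Data.List.Base using (List; []; _∷_; length; lookup; applyUpTo)
open import Data.List.Properties using (length-applyUpTo; lookup-applyUpTo)
open import Data.List.Relation.Binary.Prefix.Heterogeneous using (Prefix; _∷_)
open import Data.List.Relation.Binary.Prefix.Heterogeneous.Properties using (length-mono)
open import Data.Maybe.Base using (Maybe; just; nothing; fromMaybe)
open import Data.Maybe.Relation.Unary.All as Maybe using (just; nothing)
open import Data.Nat.Base using (ℕ; zero; suc; _<_; _⊔_; s≤s)
open import Data.Nat.Properties
  using (m≤m⊔n; m≤n⊔m; m<1+n⇒m<n∨m≡n; ≤-reflexive; <-≤-trans)
open import Data.Product.Base using (_×_; _,_; Σ-syntax)
open import Data.Sum.Base using (inj₁; inj₂)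
open import Function.Base using (_∘_)
open import Function.Bundles using (mk⇔; Equivalence)
open import Relation.Binary.PropositionalEquality
  using (_≡_; refl; sym; trans; cong; subst; subst₂)
open import Relation.Nullary.Decidable using (Dec; yes; does; dec-true)

private
  variable
    A : Set

∃ᴾ-intro : ∀ {a b} {A : Set a} {B : A → Set b} (x : A) → B x → ∃ᴾ[ y ] B y
∃ᴾ-intro x p _ _ k = k x p

does-true⇒ : (d : Dec A) → does d ≡ true → A
does-true⇒ (yes p) _ = p

lookup-prefix : ∀ {u v : List A} → Prefix _≡_ u v → (i : Fin (length u)) →
                Σ[ j ∈ Fin (length v) ] (toℕ j ≡ toℕ i × lookup v j ≡ lookup u i)
lookup-prefix (refl ∷ p) zero    = zero , refl , refl
lookup-prefix (refl ∷ p) (suc i) with lookup-prefix p i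
... | j , j≡i , eq = suc j , cong suc j≡i , eq

lastJust : (ℕ → Maybe A) → A → ℕ → A
lastJust s d zero    = d
lastJust s d (suc n) = fromMaybe (lastJust s d n) (s n)

SingleValued : (ℕ → Maybe A) → Set
SingleValued s = ∀ {k l a b} → s k ≡ just a → s l ≡ just b → a ≡ b

-- A later stage may override stage `k`, but single-valuedness forces it to carry the same value.
lastJust-≡ : ∀ (s : ℕ → Maybe A) d → SingleValued s →
             ∀ n {k b} → k < n → s k ≡ just b → lastJust s d n ≡ b
lastJust-≡ s d sv (suc n) k<1+n sk with s n in sn | m<1+n⇒m<n∨m≡n k<1+n
... | just _  | _         = sv sn sk
... | nothing | inj₁ k<n  = lastJust-≡ s d sv n k<n sk
... | nothing | inj₂ refl with () ← trans (sym sn) sk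

module KleeneTree (s : ℕ → ℕ → Maybe Bool) where

  -- Bounding the stage `k` by the length, like the position `i`, leaves finitely many conditions,
  -- hence decidability. A stage with value `nothing` imposes no condition.
  τ : List Bool → Set
  τ u = (i k : Fin (length u)) → Maybe.All (lookup u i ≡_) (s (toℕ i) (toℕ k))

  τ? : ∀ u → Dec (τ u)
  τ? u = all? λ i → all? λ k → Maybe.dec (lookup u i ≟_) (s (toℕ i) (toℕ k))

  -- A shorter list has fewer positions and fewer stages, so its conditions are among those of the
  -- longer one.
  τ-prefixClosed : ∀ {u v} → Prefix _≡_ u v → τ v → τ u
  τ-prefixClosed p t i k with lookup-prefix p i
  ... | j , j≡i , eq =
    subst₂ (λ b m → Maybe.All (b ≡_) m) eq
      (trans (cong (λ x → s x (toℕ k′)) j≡i) (cong (s (toℕ i)) (toℕ-inject≤ k (length-mono p))))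
      (t j k′)
    where k′ = inject≤ k (length-mono p)

  isDecidableBinaryTree : IsDecidableBinaryTree τ
  isDecidableBinaryTree = record
    { decidable    = ∃ᴾ-intro (does ∘ τ?) λ u → mk⇔ (dec-true (τ? u)) (does-true⇒ (τ? u))
    ; inhabited    = ∃ᴾ-intro [] λ ()
    ; prefixClosed = τ-prefixClosed
    }

  infinite : (∀ n → SingleValued (s n)) → IsInfinite τ
  infinite sv n =
    ∃ᴾ-intro (applyUpTo g n) (≤-reflexive (sym (length-applyUpTo g n)) , node)
    where
    g : ℕ → Bool
    -- The default `true` is arbitrary: it is used only where no stage below `n` constrains the
    -- entry. As `g` depends on `n`, nodes for different `n` need not lie on one path.
    g i = lastJust (s i) true n

    node : τ (applyUpTo g n)
    node i k with s (toℕ i) (toℕ k) in eq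
    ... | nothing = nothing
    ... | just b  = just (trans (lookup-applyUpTo g n i)
            (lastJust-≡ (s (toℕ i)) true (sv (toℕ i)) n
              (<-≤-trans (toℕ<n k) (≤-reflexive (length-applyUpTo g n))) eq))

  τ-agrees : ∀ (f : ℕ → Bool) {n c k b} → c < n → k < n →
             τ (applyUpTo f n) → s c k ≡ just b → f c ≡ b
  τ-agrees f {n} {c} {k} {b} c<n k<n t eq =
    trans (sym (trans (lookup-applyUpTo f n i) (cong f (toℕ-fromℕ< _))))
      (Maybe.drop-just (subst (Maybe.All _) s≡ (t i j)))
    where
    len = ≤-reflexive (sym (length-applyUpTo f n))
    i   = fromℕ< (<-≤-trans c<n len)
    j   = fromℕ< (<-≤-trans k<n len)

    s≡ : s (toℕ i) (toℕ j) ≡ just b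
    s≡ = subst₂ (λ x y → s x y ≡ just b) (sym (toℕ-fromℕ< _)) (sym (toℕ-fromℕ< _)) eq

theorem27 : (P : Partiality) → EPF𝔹 P → KT
theorem27 P (e , complete) =
  ∃ᴾ-intro τ (isDecidableBinaryTree , infinite singleValued , wellFounded)
  where
  open Partiality P
  open Equivalence

  open KleeneTree (λ n → seval (e n n))

  singleValued : ∀ n → SingleValued (seval (e n n))
  singleValued n p q =
    ▷-functional (from (seval-spec _ _) (∃ᴾ-intro _ p)) (from (seval-spec _ _) (∃ᴾ-intro _ q))

  wellFounded : IsWellFounded τ
  wellFounded f X irr found =
    -- The goal is itself an encoded existence, so `c` and then `k` may be extracted into its `X`.
    complete (λ n → ret (not (f n))) X irr λ c ec≡ →
    to (seval-spec _ _) (from (ec≡ c (not (f c))) (ret-spec _)) X irr λ k eq →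
    -- The list `f 0 , … , f (c ⊔ k)` has length `suc (c ⊔ k)`, so both `c` and `k` are in range;
    -- membership would give `f c ≡ not (f c)`.
    found (c ⊔ k) λ t →
      not-¬ refl (τ-agrees f (s≤s (m≤m⊔n c k)) (s≤s (m≤n⊔m c k)) t eq)
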